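{- There is a computable function that associates to each pair $(t,T)$, where $T$ is a finite nonempty set of tile symbols and $P_t\in T$, a first-order sentence $\varphi_{(t,T)}$ of the vocabulary $\tau:=\{H,V,R\}\cup T$ such that the grid $\mathfrak{G}$ is $t$-recurrently $T$-tilable if and only if there exists an expansion $\mathfrak{R}^*$ of the recurrence grid $\mathfrak{R}$ to the vocabulary $\tau$ with $\mathfrak{R}^*\models\varphi_{(t,T)}$.
   Context: The grid is $\mathfrak{G}=(\mathbb{N}^2,H,V)$ with $H=\{((i,j),(i+1,j)) : i,j\in\mathbb{N}\}$ and $V=\{((i,j),(i,j+1)) : i,j\in\mathbb{N}\}$. The recurrence grid is $\mathfrak{R}=(\mathfrak{G},R)$ where $R=\{((0,i),(0,j)) : i<j\}$. A tile type is a function $t:\{0,1,2,3\}\to\mathbb{N}$ ($t(0),t(1),t(2),t(3)$ are the top, right, bottom, left colours), and $P_t$ is a unary relation symbol (tile symbol) associated with $t$. For a finite nonempty set $T$ of tile symbols with $P_t\in T$, the grid $\mathfrak{G}$ is $t$-recurrently $T$-tilable if there is an expansion of $\mathfrak{G}$ to $\{H,V\}\cup T$ such that: each point lies in exactly one symbol of $T$; if $uHv$ then the right colour of the tile at $u$ equals the left colour of the tile at $v$; if $uVv$ then the top colour of the tile at $u$ equals the bottom colour of the tile at $v$; and there are infinitely many $i\in\mathbb{N}$ such that $P_t((0,i))$ holds. -}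

module Defs where

open import Data.Nat using (ℕ; zero; suc; _<_; _≤_)
open import Data.Fin using (Fin)
open import Data.Product using (Σ; _×_; _,_)
open import Data.Sum using (_⊎_)
open import Data.Empty using (⊥)
open import Data.Unit using (⊤)
open import Relation.Binary.PropositionalEquality using (_≡_)

Point : Set
Point = ℕ × ℕ

HRel : Point → Point → Set
HRel (i , j) (i' , j') = (i' ≡ suc i) × (j' ≡ j)

VRel : Point → Point → Set
VRel (i , j) (i' , j') = (i' ≡ i) × (j' ≡ suc j)

RRel : Point → Point → Set
RRel (i , j) (i' , j') = (i ≡ 0) × (i' ≡ 0) × (j < j')

TileType : Set
TileType = Fin 4 → ℕ

top right bottom left : TileType → ℕ
top t = t (Fin.zero)
  where open import Data.Fin using (zero)
right t = t (Fin.suc Fin.zero)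
  where open import Data.Fin using (zero; suc)
bottom t = t (Fin.suc (Fin.suc Fin.zero))
  where open import Data.Fin using (zero; suc)
left t = t (Fin.suc (Fin.suc (Fin.suc Fin.zero)))
  where open import Data.Fin using (zero; suc)

-- A finite nonempty set T of tile symbols is given by k = suc n symbols,
-- symbol a : Fin k being P_{ts a}; distinct symbols have distinct types.
DistinctTypes : {k : ℕ} → (Fin k → TileType) → Set
DistinctTypes {k} ts = (a b : Fin k) → (∀ d → ts a d ≡ ts b d) → a ≡ b

Interp : ℕ → Set₁
Interp k = Fin k → Point → Set

-- t-recurrent T-tilability of the grid 𝔊 (t is the symbol index a).
RecTilable : {k : ℕ} → (Fin k → TileType) → Fin k → Set₁
RecTilable {k} ts a = Σ (Interp k) λ P →
    ((u : Point) → Σ (Fin k) λ b → P b u × ((c : Fin k) → P c u → c ≡ b))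
  × ((u v : Point) → HRel u v → (b c : Fin k) → P b u → P c v →
        right (ts b) ≡ left (ts c))
  × ((u v : Point) → VRel u v → (b c : Fin k) → P b u → P c v →
        top (ts b) ≡ bottom (ts c))
  × ((m : ℕ) → Σ ℕ λ i → (m ≤ i) × P a (0 , i))

-- First-order formulas over τ = {H, V, R} ∪ T (T = k unary symbols),
-- with m free variables (de Bruijn, Fin m), equality included.
data Formula (k : ℕ) : ℕ → Set where
  H V R  : {m : ℕ} → Fin m → Fin m → Formula k m
  P      : {m : ℕ} → Fin k → Fin m → Formula k m
  _≐_    : {m : ℕ} → Fin m → Fin m → Formula k m
  ff     : {m : ℕ} → Formula k m
  ¬'_    : {m : ℕ} → Formula k m → Formula k m
  _∧'_ _∨'_ _⇒'_ : {m : ℕ} → Formula k m → Formula k m → Formula k m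
  ∀' ∃'  : {m : ℕ} → Formula k (suc m) → Formula k m

Sentence : ℕ → Set
Sentence k = Formula k 0

extend : {m : ℕ} → (Fin m → Point) → Point → Fin (suc m) → Point
extend ρ x Fin.zero = x
extend ρ x (Fin.suc i) = ρ i

Sat : {k m : ℕ} → Interp k → (Fin m → Point) → Formula k m → Set
Sat I ρ (H x y) = HRel (ρ x) (ρ y)
Sat I ρ (V x y) = VRel (ρ x) (ρ y)
Sat I ρ (R x y) = RRel (ρ x) (ρ y)
Sat I ρ (P b x) = I b (ρ x)
Sat I ρ (x ≐ y) = ρ x ≡ ρ y
Sat I ρ ff = ⊥
Sat I ρ (¬' φ) = Sat I ρ φ → ⊥
Sat I ρ (φ ∧' ψ) = Sat I ρ φ × Sat I ρ ψ
Sat I ρ (φ ∨' ψ) = Sat I ρ φ ⊎ Sat I ρ ψ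
Sat I ρ (φ ⇒' ψ) = Sat I ρ φ → Sat I ρ ψ
Sat I ρ (∀' φ) = (x : Point) → Sat I (extend ρ x) φ
Sat I ρ (∃' φ) = Σ Point λ x → Sat I (extend ρ x) φ

empty : Fin 0 → Point
empty ()

_⊨_ : {k : ℕ} → Interp k → Sentence k → Set
I ⊨ φ = Sat I empty φ

module Submission where

open import Defs
open import Data.Nat using (ℕ; zero; suc; _≤_)
open import Data.Nat.Properties using (≤-refl; <⇒≤)
import Data.Nat.Properties as ℕ
open import Data.Fin using (Fin) renaming (zero to fzero; suc to fsuc)
import Data.Fin.Properties as Fin
open import Data.Product using (Σ; _×_; _,_; proj₁; proj₂)
open import Data.Sum using (inj₁; inj₂)
open import Data.Empty using (⊥-elim)
open import Function.Bundles using (_⇔_; mk⇔; Equivalence)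
open import Relation.Nullary using (Dec; yes; no)
open import Relation.Binary.PropositionalEquality using (_≡_; refl; sym; trans; subst)

-- Being a tiling is a universal first-order property of the expansion: every
-- point carries a tile, no point carries two, and H- and V-neighbours carry
-- tiles whose colours match, each a finite conjunction over pairs of tiles.
-- Recurrence is not first-order over the grid alone, but R makes it so: the
-- points with an R-successor are exactly those of the first column, so
-- "every point with an R-successor has one in P_t" says that P_t meets the
-- first column above every height.

open Equivalence using (to; from)

⋀ : {k m n : ℕ} → (Fin n → Formula k m) → Formula k m
⋀ {n = zero}  f = ¬' ff
⋀ {n = suc n} f = f fzero ∧' ⋀ (λ i → f (fsuc i))

⋁ : {k m n : ℕ} → (Fin n → Formula k m) → Formula k m
⋁ {n = zero}  f = ff
⋁ {n = suc n} f = f fzero ∨' ⋁ (λ i → f (fsuc i))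

_onlyIf_ : {k m : ℕ} {A : Set} → Formula k m → Dec A → Formula k m
φ onlyIf yes _ = ¬' ff
φ onlyIf no  _ = ¬' φ

compatible : {k m : ℕ} {A : Fin k → Fin k → Set} → (∀ b c → Dec (A b c)) → Fin m → Fin m → Formula k m
compatible d x y = ⋀ λ b → ⋀ λ c → (P b x ∧' P c y) onlyIf d b c

module _ {k m : ℕ} (I : Interp k) (ρ : Fin m → Point) where

  Sat-⋀ : {n : ℕ} (f : Fin n → Formula k m) →
          Sat I ρ (⋀ f) ⇔ ((i : Fin n) → Sat I ρ (f i))
  Sat-⋀ {zero}  f = mk⇔ (λ _ ()) (λ _ z → z)
  Sat-⋀ {suc n} f = mk⇔
    (λ { (s , ss) fzero → s ; (s , ss) (fsuc i) → to (Sat-⋀ (λ i → f (fsuc i))) ss i })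
    (λ h → h fzero , from (Sat-⋀ (λ i → f (fsuc i))) (λ i → h (fsuc i)))

  Sat-⋁ : {n : ℕ} (f : Fin n → Formula k m) →
          Sat I ρ (⋁ f) ⇔ Σ (Fin n) (λ i → Sat I ρ (f i))
  Sat-⋁ {zero}  f = mk⇔ (λ ()) (λ ())
  Sat-⋁ {suc n} f = mk⇔ to′ from′
    where
    to′ : Sat I ρ (⋁ f) → Σ (Fin (suc n)) (λ i → Sat I ρ (f i))
    to′ (inj₁ s) = fzero , s
    to′ (inj₂ s) with to (Sat-⋁ (λ i → f (fsuc i))) s
    ... | i , t = fsuc i , t
    from′ : Σ (Fin (suc n)) (λ i → Sat I ρ (f i)) → Sat I ρ (⋁ f)
    from′ (fzero , s)  = inj₁ s
    from′ (fsuc i , s) = inj₂ (from (Sat-⋁ (λ i → f (fsuc i))) (i , s))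

  Sat-onlyIf : {A : Set} (φ : Formula k m) (d : Dec A) →
               Sat I ρ (φ onlyIf d) ⇔ (Sat I ρ φ → A)
  Sat-onlyIf φ (yes a) = mk⇔ (λ _ _ → a) (λ _ z → z)
  Sat-onlyIf φ (no ¬a) = mk⇔ (λ ¬φ s → ⊥-elim (¬φ s)) (λ h s → ¬a (h s))

  Sat-compatible : {A : Fin k → Fin k → Set} (d : ∀ b c → Dec (A b c)) (x y : Fin m) →
                   Sat I ρ (compatible d x y) ⇔ (∀ b c → I b (ρ x) → I c (ρ y) → A b c)
  Sat-compatible d x y = mk⇔
    (λ s b c pb pc → to (Sat-onlyIf _ (d b c)) (to (Sat-⋀ _) (to (Sat-⋀ _) s b) c) (pb , pc))
    (λ h → from (Sat-⋀ _) λ b → from (Sat-⋀ _) λ c →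
             from (Sat-onlyIf _ (d b c)) λ (pb , pc) → h b c pb pc)

module _ {k : ℕ} (I : Interp k) where

  Covered : Set
  Covered = (u : Point) → Σ (Fin k) λ b → I b u

  Disjoint : Set
  Disjoint = (u : Point) (b c : Fin k) → I b u → I c u → b ≡ c

  ExactlyOne : Set
  ExactlyOne = (u : Point) → Σ (Fin k) λ b → I b u × ((c : Fin k) → I c u → c ≡ b)

  exactlyOne⇔covered×disjoint : ExactlyOne ⇔ (Covered × Disjoint)
  exactlyOne⇔covered×disjoint = mk⇔
    (λ one → (λ u → proj₁ (one u) , proj₁ (proj₂ (one u)))
           , λ u b c pb pc → let only = proj₂ (proj₂ (one u)) in trans (only b pb) (sym (only c pc)))
    (λ (cov , disj) u → let (b , pb) = cov u in b , pb , λ c pc → disj u c b pc pb)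

module _ {k : ℕ} (ts : Fin k → TileType) (I : Interp k) where

  HMatching : Set
  HMatching = (u v : Point) → HRel u v → (b c : Fin k) → I b u → I c v →
              right (ts b) ≡ left (ts c)

  VMatching : Set
  VMatching = (u v : Point) → VRel u v → (b c : Fin k) → I b u → I c v →
              top (ts b) ≡ bottom (ts c)

module _ {k : ℕ} (I : Interp k) (t : Fin k) where

  Recurrent : Set
  Recurrent = (m : ℕ) → Σ ℕ λ i → (m ≤ i) × I t (0 , i)

  RSuccessorsMeet : Set
  RSuccessorsMeet = (u : Point) → Σ Point (RRel u) → Σ Point λ v → RRel u v × I t v

  recurrent⇔RSuccessorsMeet : Recurrent ⇔ RSuccessorsMeet
  recurrent⇔RSuccessorsMeet = mk⇔ to′ from′
    where
    to′ : Recurrent → RSuccessorsMeet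
    to′ rec (_ , j) (_ , (u₁≡0 , _)) =
      let (i , j<i , pi) = rec (suc j) in (0 , i) , (u₁≡0 , refl , j<i) , pi
    from′ : RSuccessorsMeet → Recurrent
    from′ meet m with meet (0 , m) ((0 , suc m) , refl , refl , ≤-refl)
    ... | (_ , i) , (_ , v₁≡0 , m<i) , pv = i , <⇒≤ m<i , subst (λ p → I t (p , i)) v₁≡0 pv

x₀ x₁ : {m : ℕ} → Fin (suc (suc m))
x₀ = fzero
x₁ = fsuc fzero

hMatch? : {k : ℕ} (ts : Fin k → TileType) (b c : Fin k) → Dec (right (ts b) ≡ left (ts c))
hMatch? ts b c = right (ts b) ℕ.≟ left (ts c)

vMatch? : {k : ℕ} (ts : Fin k → TileType) (b c : Fin k) → Dec (top (ts b) ≡ bottom (ts c))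
vMatch? ts b c = top (ts b) ℕ.≟ bottom (ts c)

recurrentTilingSentence : {k : ℕ} → (Fin k → TileType) → Fin k → Sentence k
recurrentTilingSentence ts t =
      ∀' (⋁ λ b → P b fzero)
   ∧' (∀' (compatible Fin._≟_ fzero fzero)
   ∧' (∀' (∀' (H x₁ x₀ ⇒' compatible (hMatch? ts) x₁ x₀))
   ∧' (∀' (∀' (V x₁ x₀ ⇒' compatible (vMatch? ts) x₁ x₀))
   ∧' ∀' (∃' (R x₁ x₀) ⇒' ∃' (R x₁ x₀ ∧' P t x₀)))))

module _ {k : ℕ} (ts : Fin k → TileType) (t : Fin k) (I : Interp k) where

  ⊨recurrentTilingSentence⇔ :
    I ⊨ recurrentTilingSentence ts t
      ⇔ (ExactlyOne I × HMatching ts I × VMatching ts I × Recurrent I t)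
  ⊨recurrentTilingSentence⇔ = mk⇔
    (λ (cov , disj , hm , vm , rec) →
         from (exactlyOne⇔covered×disjoint I)
              ( (λ u → to (Sat-⋁ I (ρ₁ u) _) (cov u))
              , (λ u → to (Sat-compatible I (ρ₁ u) Fin._≟_ fzero fzero) (disj u)))
       , (λ u v uHv → to (Sat-compatible I (ρ₂ u v) (hMatch? ts) x₁ x₀) (hm u v uHv))
       , (λ u v uVv → to (Sat-compatible I (ρ₂ u v) (vMatch? ts) x₁ x₀) (vm u v uVv))
       , from (recurrent⇔RSuccessorsMeet I t) rec)
    (λ (one , hm , vm , rec) →
       let (cov , disj) = to (exactlyOne⇔covered×disjoint I) one in
         (λ u → from (Sat-⋁ I (ρ₁ u) _) (cov u))
       , (λ u → from (Sat-compatible I (ρ₁ u) Fin._≟_ fzero fzero) (disj u))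
       , (λ u v uHv → from (Sat-compatible I (ρ₂ u v) (hMatch? ts) x₁ x₀) (hm u v uHv))
       , (λ u v uVv → from (Sat-compatible I (ρ₂ u v) (vMatch? ts) x₁ x₀) (vm u v uVv))
       , to (recurrent⇔RSuccessorsMeet I t) rec)
    where
    ρ₁ : Point → Fin 1 → Point
    ρ₁ u = extend empty u

    ρ₂ : Point → Point → Fin 2 → Point
    ρ₂ u v = extend (extend empty u) v

lemma2p6 : Σ ((n : ℕ) → (Fin (suc n) → TileType) → Fin (suc n) → Sentence (suc n)) λ φ →
    (n : ℕ) (ts : Fin (suc n) → TileType) (a : Fin (suc n)) → DistinctTypes ts →
      (RecTilable ts a → Σ (Interp (suc n)) λ I → I ⊨ φ n ts a)
      × (Σ (Interp (suc n)) (λ I → I ⊨ φ n ts a) → RecTilable ts a)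
lemma2p6 = (λ _ → recurrentTilingSentence) , λ _ ts a _ →
    (λ (I , tiling) → I , from (⊨recurrentTilingSentence⇔ ts a I) tiling)
  , (λ (I , ⊨φ) → I , to (⊨recurrentTilingSentence⇔ ts a I) ⊨φ)
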